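{- Let $\alpha,\beta,\gamma,\delta\in\mathcal{L}$ be Lipschitz integers. Then $$(\alpha\beta)\times(\alpha\gamma)\times\delta=\alpha\,\bigl(\beta\times\gamma\times(\bar{\alpha}\delta)\bigr)\in\alpha\mathcal{L},$$ $$(\beta\alpha)\times(\gamma\alpha)\times\delta=\bigl(\beta\times\gamma\times(\delta\bar{\alpha})\bigr)\,\alpha\in\mathcal{L}\alpha .$$
   Context: $\mathbb{H}$ is the real quaternion algebra with basis $1,i,j,k$ ($i^2=j^2=k^2=ijk=-1$), identified with $\mathbb{R}^4$ via $(1,i,j,k)=(\mathbf{e}_1,\mathbf{e}_2,\mathbf{e}_3,\mathbf{e}_4)$; $\bar{u}$ denotes the quaternion conjugate. $\mathcal{L}=\mathbb{Z}+\mathbb{Z}i+\mathbb{Z}j+\mathbb{Z}k$ is the ring of Lipschitz integers; $\alpha\mathcal{L}=\{\alpha x: x\in\mathcal{L}\}$ and $\mathcal{L}\alpha=\{x\alpha: x\in\mathcal{L}\}$. The ternary vector product of $u,v,w\in\mathbb{H}$, with $u=u_0+u_1i+u_2j+u_3k$ and similarly for $v,w$, is $$u\times v\times w=\begin{vmatrix}u_0&u_1&u_2&u_3\\ v_0&v_1&v_2&v_3\\ w_0&w_1&w_2&w_3\\ 1&i&j&k\end{vmatrix},$$ the formal determinant being computed by Laplace expansion along the last row. -}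

module Defs where

open import Data.Fin.Base using (Fin; zero; suc; toℕ)
open import Data.Integer.Base
  using (ℤ; 0ℤ; 1ℤ; -1ℤ; _+_; _-_; _*_; -_; _^_; +-0-rawMonoid)
open import Data.Nat.Base as ℕ using (zero; suc)
open import Data.Product.Base using (∃-syntax)
open import Data.Vec.Functional using (Vector; []; _∷_; foldr; removeAt)
open import Level using (0ℓ)
open import Relation.Binary.PropositionalEquality using (_≡_; refl)
open import Relation.Unary using (Pred)

open import Algebra.Definitions.RawMonoid +-0-rawMonoid using (sum)

-- The Lipschitz order inside the real quaternions: ⟨ a , b , c , d ⟩ is
-- a + b i + c j + d k.  It is closed under all the operations used below,
-- so the ambient real algebra is never needed.

record ℒ : Set where
  constructor ⟨_,_,_,_⟩
  field
    re im-i im-j im-k : ℤ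

infixl 7 _·_
infixl 7 _•_
infixl 6 _⊕_
infix  5 _⨯_⨯_

0ℒ 1ℒ i j k : ℒ
0ℒ = ⟨ 0ℤ , 0ℤ , 0ℤ , 0ℤ ⟩
1ℒ = ⟨ 1ℤ , 0ℤ , 0ℤ , 0ℤ ⟩
i  = ⟨ 0ℤ , 1ℤ , 0ℤ , 0ℤ ⟩
j  = ⟨ 0ℤ , 0ℤ , 1ℤ , 0ℤ ⟩
k  = ⟨ 0ℤ , 0ℤ , 0ℤ , 1ℤ ⟩

_⊕_ : ℒ → ℒ → ℒ
⟨ a , b , c , d ⟩ ⊕ ⟨ a′ , b′ , c′ , d′ ⟩ =
  ⟨ a + a′ , b + b′ , c + c′ , d + d′ ⟩

_•_ : ℤ → ℒ → ℒ
n • ⟨ a , b , c , d ⟩ = ⟨ n * a , n * b , n * c , n * d ⟩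

-- The bilinear extension of i² = j² = k² = ijk = -1.
_·_ : ℒ → ℒ → ℒ
⟨ a , b , c , d ⟩ · ⟨ a′ , b′ , c′ , d′ ⟩ =
  ⟨ a * a′ - b * b′ - c * c′ - d * d′
  , a * b′ + b * a′ + c * d′ - d * c′
  , a * c′ - b * d′ + c * a′ + d * b′
  , a * d′ + b * c′ - c * b′ + d * a′
  ⟩

conj : ℒ → ℒ
conj ⟨ a , b , c , d ⟩ = ⟨ a , - b , - c , - d ⟩

coords : ℒ → Vector ℤ 4
coords ⟨ a , b , c , d ⟩ = a ∷ b ∷ c ∷ d ∷ []

basis : Vector ℒ 4
basis = 1ℒ ∷ i ∷ j ∷ k ∷ []

-- Laplace expansion along the first row.
det : ∀ {n} → Vector (Vector ℤ n) n → ℤ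
det {zero}  M = 1ℤ
det {suc n} M =
  sum λ c → -1ℤ ^ toℕ c * M zero c * det (λ r → removeAt (M (suc r)) c)

-- The formal 4 × 4 determinant with rows u, v, w and (1, i, j, k), expanded
-- along its last row.  With 0-based indices, the last row has index 3, so the
-- cofactor sign of column c is (-1)^(3 + c).
_⨯_⨯_ : ℒ → ℒ → ℒ → ℒ
u ⨯ v ⨯ w =
  foldr _⊕_ 0ℒ λ c → (-1ℤ ^ (3 ℕ.+ toℕ c) * det (minor c)) • basis c
  where
  minor : Fin 4 → Vector (Vector ℤ 3) 3
  minor c =
    removeAt (coords u) c ∷ removeAt (coords v) c ∷ removeAt (coords w) c ∷ []

_·ℒ : ℒ → Pred ℒ 0ℓ
(α ·ℒ) y = ∃[ x ] y ≡ α · x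

ℒ·_ : ℒ → Pred ℒ 0ℓ
(ℒ· α) y = ∃[ x ] y ≡ x · α

private
  -1ℒ : ℒ
  -1ℒ = -1ℤ • 1ℒ

  i² : i · i ≡ -1ℒ
  i² = refl

  j² : j · j ≡ -1ℒ
  j² = refl

  k² : k · k ≡ -1ℒ
  k² = refl

  ijk : i · j · k ≡ -1ℒ
  ijk = refl

  1⨯i⨯j : 1ℒ ⨯ i ⨯ j ≡ k
  1⨯i⨯j = refl

  i⨯j⨯k : i ⨯ j ⨯ k ≡ -1ℒ
  i⨯j⨯k = refl

{-# OPTIONS --safe #-}
module Submission where

open import Defs
open import Data.Fin.Base using (Fin; zero; suc; toℕ)
open import Data.Fin using (#_)
open import Data.Integer.Base using (ℤ; +_; 0ℤ; 1ℤ; -1ℤ; _+_; _*_; _^_)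
open import Data.Integer.Properties using (*-cancelˡ-≡; +-0-abelianGroup)
open import Data.Integer.Solver using (module +-*-Solver)
open import Data.Nat.Base as ℕ using (ℕ)
open import Data.Product.Base using (_×_; _,_)
open import Data.Vec.Base using (Vec; []; _∷_; _++_)
open import Data.Vec.Functional as Vector using (Vector; foldr; removeAt)
open import Relation.Binary.PropositionalEquality using (_≡_; refl; cong; module ≡-Reasoning)
open import Relation.Unary using (_∈_)

open import Algebra.Properties.AbelianGroup +-0-abelianGroup using () renaming (∙-cancelʳ to +-cancelʳ)
open +-*-Solver using (Polynomial; con; var; _:+_; _:-_; _:*_; :-_; ⟦_⟧; ⟦_⟧↓; prove)
open ℒ
open ≡-Reasoning

-- Twice the ternary product is w v̄ u − u v̄ w.  Expanding both sides of each
-- identity in this way reduces it to associativity, conj (x y) = ȳ x̄, and the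
-- centrality of the norm α ᾱ = ᾱ α; the factor 2 is then cancelled.

ℒ-ext : ∀ {x y} → re x ≡ re y → im-i x ≡ im-i y → im-j x ≡ im-j y → im-k x ≡ im-k y → x ≡ y
ℒ-ext refl refl refl refl = refl

-- Quaternions with polynomial coordinates mirror ℒ operation by operation, so
-- that evaluating them gives back the operations of Defs definitionally and
-- the ring solver applies to each coordinate.

record ℒ[_] (n : ℕ) : Set where
  constructor ⟨_,_,_,_⟩
  field
    re im-i im-j im-k : Polynomial n

module _ {n : ℕ} where

  infixl 7 _:·_ _:•_
  infixl 6 _:⊕_
  infix  5 _:⨯_:⨯_

  _:⊕_ : ℒ[ n ] → ℒ[ n ] → ℒ[ n ]
  ⟨ a , b , c , d ⟩ :⊕ ⟨ a′ , b′ , c′ , d′ ⟩ =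
    ⟨ a :+ a′ , b :+ b′ , c :+ c′ , d :+ d′ ⟩

  _:•_ : Polynomial n → ℒ[ n ] → ℒ[ n ]
  m :• ⟨ a , b , c , d ⟩ = ⟨ m :* a , m :* b , m :* c , m :* d ⟩

  _:·_ : ℒ[ n ] → ℒ[ n ] → ℒ[ n ]
  ⟨ a , b , c , d ⟩ :· ⟨ a′ , b′ , c′ , d′ ⟩ =
    ⟨ a :* a′ :- b :* b′ :- c :* c′ :- d :* d′
    , a :* b′ :+ b :* a′ :+ c :* d′ :- d :* c′
    , a :* c′ :- b :* d′ :+ c :* a′ :+ d :* b′
    , a :* d′ :+ b :* c′ :- c :* b′ :+ d :* a′
    ⟩

  :conj : ℒ[ n ] → ℒ[ n ]
  :conj ⟨ a , b , c , d ⟩ = ⟨ a , :- b , :- c , :- d ⟩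

  :coords : ℒ[ n ] → Vector (Polynomial n) 4
  :coords ⟨ a , b , c , d ⟩ = a Vector.∷ b Vector.∷ c Vector.∷ d Vector.∷ Vector.[]

  :const : ℒ → ℒ[ n ]
  :const ⟨ a , b , c , d ⟩ = ⟨ con a , con b , con c , con d ⟩

  -- The `foldr` matches what `sum` unfolds to in `det`, with the signs kept as constants, so
  -- evaluation reaches `det` by computation alone.
  :det : ∀ {m} → Vector (Vector (Polynomial n) m) m → Polynomial n
  :det {ℕ.zero}  M = con 1ℤ
  :det {ℕ.suc m} M = foldr _:+_ (con 0ℤ) λ c →
    con (-1ℤ ^ toℕ c) :* M zero c :* :det (λ r → removeAt (M (suc r)) c)

  _:⨯_:⨯_ : ℒ[ n ] → ℒ[ n ] → ℒ[ n ] → ℒ[ n ]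
  u :⨯ v :⨯ w = foldr _:⊕_ (:const 0ℒ) λ c →
    (con (-1ℤ ^ (3 ℕ.+ toℕ c)) :* :det (minor c)) :• :const (basis c)
    where
    minor : Fin 4 → Vector (Vector (Polynomial n) 3) 3
    minor c = removeAt (:coords u) c Vector.∷ removeAt (:coords v) c Vector.∷
              removeAt (:coords w) c Vector.∷ Vector.[]

  eval eval↓ : Vec ℤ n → ℒ[ n ] → ℒ
  eval  ρ ⟨ a , b , c , d ⟩ = ⟨ ⟦ a ⟧ ρ  , ⟦ b ⟧ ρ  , ⟦ c ⟧ ρ  , ⟦ d ⟧ ρ  ⟩
  eval↓ ρ ⟨ a , b , c , d ⟩ = ⟨ ⟦ a ⟧↓ ρ , ⟦ b ⟧↓ ρ , ⟦ c ⟧↓ ρ , ⟦ d ⟧↓ ρ ⟩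

  -- The normal forms are compared as one quaternion equation, so a single `refl` settles all four
  -- coordinates.
  solveℒ : ∀ ρ p q → eval↓ ρ p ≡ eval↓ ρ q → eval ρ p ≡ eval ρ q
  solveℒ ρ ⟨ a , b , c , d ⟩ ⟨ a′ , b′ , c′ , d′ ⟩ eq = ℒ-ext
    (prove ρ a a′ (cong re eq))   (prove ρ b b′ (cong im-i eq))
    (prove ρ c c′ (cong im-j eq)) (prove ρ d d′ (cong im-k eq))

-- The number of further variables is left open, so that the same letters serve under both `env₂`
-- and `env₃`; the indices follow the order of concatenation there.
X : ∀ {n} → ℒ[ 4 ℕ.+ n ]
X = ⟨ var (# 0) , var (# 1) , var (# 2) , var (# 3) ⟩

Y : ∀ {n} → ℒ[ 8 ℕ.+ n ]
Y = ⟨ var (# 4) , var (# 5) , var (# 6) , var (# 7) ⟩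

Z : ∀ {n} → ℒ[ 12 ℕ.+ n ]
Z = ⟨ var (# 8) , var (# 9) , var (# 10) , var (# 11) ⟩

coordinates : ℒ → Vec ℤ 4
coordinates ⟨ a , b , c , d ⟩ = a ∷ b ∷ c ∷ d ∷ []

env₂ : ℒ → ℒ → Vec ℤ 8
env₂ x y = coordinates x ++ coordinates y

env₃ : ℒ → ℒ → ℒ → Vec ℤ 12
env₃ x y z = coordinates x ++ env₂ y z

·-assoc : ∀ x y z → (x · y) · z ≡ x · (y · z)
·-assoc x y z = solveℒ (env₃ x y z) ((X :· Y) :· Z) (X :· (Y :· Z)) refl

conj-· : ∀ x y → conj (x · y) ≡ conj y · conj x
conj-· x y = solveℒ (env₂ x y) (:conj (X :· Y)) (:conj Y :· :conj X) refl

-- Both sides are the norm of α times x. The bracketing suits the use below: it carries a factor α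
-- from one end of a product to the other.
norm-central : ∀ α x → α · (conj α · x) ≡ x · conj α · α
norm-central α x = solveℒ (env₂ α x) (X :· (:conj X :· Y)) (Y :· :conj X :· X) refl

-- Shaped to multiply the left side of `2•⨯` by α in one step.
·-distribˡ-2•⊕ : ∀ α x y → α · ((+ 2) • x ⊕ y) ≡ (+ 2) • (α · x) ⊕ α · y
·-distribˡ-2•⊕ α x y = solveℒ (env₃ α x y)
  (X :· (con (+ 2) :• Y :⊕ Z)) (con (+ 2) :• (X :· Y) :⊕ X :· Z) refl

·-distribʳ-2•⊕ : ∀ α x y → ((+ 2) • x ⊕ y) · α ≡ (+ 2) • (x · α) ⊕ y · α
·-distribʳ-2•⊕ α x y = solveℒ (env₃ α x y)
  ((con (+ 2) :• Y :⊕ Z) :· X) (con (+ 2) :• (Y :· X) :⊕ Z :· X) refl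

-- The difference w v̄ u - u v̄ w is trilinear and vanishes when two arguments coincide, since x x̄
-- = x̄ x is central; so it is alternating, like the determinant. Here the identity is checked by
-- expanding in the twelve coordinates. Keeping u v̄ w on the left avoids subtraction and fits
-- `2•⊕-cancel`.
2•⨯ : ∀ u v w → (+ 2) • (u ⨯ v ⨯ w) ⊕ u · conj v · w ≡ w · conj v · u
2•⨯ u v w = solveℒ (env₃ u v w)
  (con (+ 2) :• (X :⨯ Y :⨯ Z) :⊕ X :· :conj Y :· Z) (Z :· :conj Y :· X) refl

2•⊕-cancel : ∀ x y z → (+ 2) • x ⊕ z ≡ (+ 2) • y ⊕ z → x ≡ y
2•⊕-cancel x y z eq = ℒ-ext
  (cancel (re x) (re y) (re z) (cong re eq))
  (cancel (im-i x) (im-i y) (im-i z) (cong im-i eq))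
  (cancel (im-j x) (im-j y) (im-j z) (cong im-j eq))
  (cancel (im-k x) (im-k y) (im-k z) (cong im-k eq))
  where
  cancel : ∀ a b c → (+ 2) * a + c ≡ (+ 2) * b + c → a ≡ b
  cancel a b c eq = *-cancelˡ-≡ (+ 2) a b (+-cancelʳ c ((+ 2) * a) ((+ 2) * b) eq)

-- The terms u v̄ w of the two sides agree by mere reassociation, both being α β γ̄ ᾱ δ; this is the
-- summand to cancel. Only the terms w v̄ u need the centrality of the norm.
⨯-·ˡ : ∀ α β γ δ → ((α · β) ⨯ (α · γ) ⨯ δ) ≡ α · (β ⨯ γ ⨯ (conj α · δ))
⨯-·ˡ α β γ δ = 2•⊕-cancel P (α · Q) (α · (β · conj γ · (conj α · δ))) (begin
  (+ 2) • P ⊕ α · (β · conj γ · (conj α · δ))   ≡⟨ cong ((+ 2) • P ⊕_) u·v̄·w ⟨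
  (+ 2) • P ⊕ α · β · conj (α · γ) · δ          ≡⟨ 2•⨯ (α · β) (α · γ) δ ⟩
  δ · conj (α · γ) · (α · β)                    ≡⟨ w·v̄·u ⟩
  α · (conj α · δ · conj γ · β)                 ≡⟨ cong (α ·_) (2•⨯ β γ (conj α · δ)) ⟨
  α · ((+ 2) • Q ⊕ β · conj γ · (conj α · δ))   ≡⟨ ·-distribˡ-2•⊕ α Q (β · conj γ · (conj α · δ)) ⟩
  (+ 2) • (α · Q) ⊕ α · (β · conj γ · (conj α · δ)) ∎)
  where
  P Q : ℒ
  P = (α · β) ⨯ (α · γ) ⨯ δ
  Q = β ⨯ γ ⨯ (conj α · δ)

  u·v̄·w : α · β · conj (α · γ) · δ ≡ α · (β · conj γ · (conj α · δ))
  u·v̄·w = begin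
    α · β · conj (α · γ) · δ         ≡⟨ cong (λ t → α · β · t · δ) (conj-· α γ) ⟩
    α · β · (conj γ · conj α) · δ    ≡⟨ cong (_· δ) (·-assoc (α · β) (conj γ) (conj α)) ⟨
    α · β · conj γ · conj α · δ      ≡⟨ ·-assoc (α · β · conj γ) (conj α) δ ⟩
    α · β · conj γ · (conj α · δ)    ≡⟨ cong (_· (conj α · δ)) (·-assoc α β (conj γ)) ⟩
    α · (β · conj γ) · (conj α · δ)  ≡⟨ ·-assoc α (β · conj γ) (conj α · δ) ⟩
    α · (β · conj γ · (conj α · δ))  ∎

  w·v̄·u : δ · conj (α · γ) · (α · β) ≡ α · (conj α · δ · conj γ · β)
  w·v̄·u = begin
    δ · conj (α · γ) · (α · β)       ≡⟨ cong (λ t → δ · t · (α · β)) (conj-· α γ) ⟩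
    δ · (conj γ · conj α) · (α · β)  ≡⟨ cong (_· (α · β)) (·-assoc δ (conj γ) (conj α)) ⟨
    δ · conj γ · conj α · (α · β)    ≡⟨ ·-assoc (δ · conj γ · conj α) α β ⟨
    -- The inner norm ᾱ α moves to the front as α ᾱ, which supplies the outer factor α and the ᾱ
    -- next to δ.
    δ · conj γ · conj α · α · β      ≡⟨ cong (_· β) (norm-central α (δ · conj γ)) ⟨
    α · (conj α · (δ · conj γ)) · β  ≡⟨ cong (λ t → α · t · β) (·-assoc (conj α) δ (conj γ)) ⟨
    α · (conj α · δ · conj γ) · β    ≡⟨ ·-assoc α (conj α · δ · conj γ) β ⟩
    α · (conj α · δ · conj γ · β)    ∎

-- The roles are exchanged: w v̄ u now matches by reassociation, and u v̄ w needs the norm.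
⨯-·ʳ : ∀ α β γ δ → ((β · α) ⨯ (γ · α) ⨯ δ) ≡ (β ⨯ γ ⨯ (δ · conj α)) · α
⨯-·ʳ α β γ δ = 2•⊕-cancel P (Q · α) (β · conj γ · (δ · conj α) · α) (begin
  (+ 2) • P ⊕ β · conj γ · (δ · conj α) · α     ≡⟨ cong ((+ 2) • P ⊕_) u·v̄·w ⟨
  (+ 2) • P ⊕ β · α · conj (γ · α) · δ          ≡⟨ 2•⨯ (β · α) (γ · α) δ ⟩
  δ · conj (γ · α) · (β · α)                    ≡⟨ w·v̄·u ⟩
  δ · conj α · conj γ · β · α                   ≡⟨ cong (_· α) (2•⨯ β γ (δ · conj α)) ⟨
  ((+ 2) • Q ⊕ β · conj γ · (δ · conj α)) · α   ≡⟨ ·-distribʳ-2•⊕ α Q (β · conj γ · (δ · conj α)) ⟩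
  (+ 2) • (Q · α) ⊕ β · conj γ · (δ · conj α) · α ∎)
  where
  P Q : ℒ
  P = (β · α) ⨯ (γ · α) ⨯ δ
  Q = β ⨯ γ ⨯ (δ · conj α)

  u·v̄·w : β · α · conj (γ · α) · δ ≡ β · conj γ · (δ · conj α) · α
  u·v̄·w = begin
    β · α · conj (γ · α) · δ         ≡⟨ cong (λ t → β · α · t · δ) (conj-· γ α) ⟩
    β · α · (conj α · conj γ) · δ    ≡⟨ ·-assoc (β · α) (conj α · conj γ) δ ⟩
    β · α · (conj α · conj γ · δ)    ≡⟨ ·-assoc β α (conj α · conj γ · δ) ⟩
    β · (α · (conj α · conj γ · δ))  ≡⟨ cong (λ t → β · (α · t)) (·-assoc (conj α) (conj γ) δ) ⟩
    -- The norm α ᾱ passes to the right of γ̄ δ as ᾱ α, leaving ᾱ next to δ and α at the right end.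
    β · (α · (conj α · (conj γ · δ))) ≡⟨ cong (β ·_) (norm-central α (conj γ · δ)) ⟩
    β · (conj γ · δ · conj α · α)    ≡⟨ ·-assoc β (conj γ · δ · conj α) α ⟨
    β · (conj γ · δ · conj α) · α    ≡⟨ cong (λ t → β · t · α) (·-assoc (conj γ) δ (conj α)) ⟩
    β · (conj γ · (δ · conj α)) · α  ≡⟨ cong (_· α) (·-assoc β (conj γ) (δ · conj α)) ⟨
    β · conj γ · (δ · conj α) · α    ∎

  w·v̄·u : δ · conj (γ · α) · (β · α) ≡ δ · conj α · conj γ · β · α
  w·v̄·u = begin
    δ · conj (γ · α) · (β · α)       ≡⟨ cong (λ t → δ · t · (β · α)) (conj-· γ α) ⟩
    δ · (conj α · conj γ) · (β · α)  ≡⟨ cong (_· (β · α)) (·-assoc δ (conj α) (conj γ)) ⟨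
    δ · conj α · conj γ · (β · α)    ≡⟨ ·-assoc (δ · conj α · conj γ) β α ⟨
    δ · conj α · conj γ · β · α      ∎

theorem5p6 : (α β γ δ : ℒ) →
    ( ((α · β) ⨯ (α · γ) ⨯ δ) ≡ α · (β ⨯ γ ⨯ (conj α · δ))
    × ((α · β) ⨯ (α · γ) ⨯ δ) ∈ (α ·ℒ) )
    × ( ((β · α) ⨯ (γ · α) ⨯ δ) ≡ (β ⨯ γ ⨯ (δ · conj α)) · α
    × ((β · α) ⨯ (γ · α) ⨯ δ) ∈ (ℒ· α) )
theorem5p6 α β γ δ =
  -- Each identity doubles as the membership proof, its ternary product being the witness.
  (⨯-·ˡ α β γ δ , β ⨯ γ ⨯ (conj α · δ) , ⨯-·ˡ α β γ δ) ,
  (⨯-·ʳ α β γ δ , β ⨯ γ ⨯ (δ · conj α) , ⨯-·ʳ α β γ δ)
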